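{- For every $n\ge1$, the set $\mathbb{YFT}_n$ of standard Young-Fibonacci tableaux of size $n$, equipped with the relation $\preceq$, is a graded poset, the rank of a tableau $t$ being the number of inversions of its minimal canonical permutation $w_{min}^{t}$.
   Context: **Tableaux.** A snakeshape of size $n$ is a word $u=u_1\cdots u_k$ with letters in $\{1,2\}$ and sum $n$, drawn as $k$ bottom-justified columns from left to right, the $i$-th column having $u_i$ boxes; in a single-boxed column the unique box is both bottom and top box. A standard Young-Fibonacci tableau of size $n$ is a numbering of a snakeshape of size $n$ with $1,\dots,n$ (each used once) such that in each two-boxed column the top entry is larger than the bottom entry, and the entry in the top box of any column is larger than all entries in the columns to its right. $\mathbb{YFT}_n$ is the set of these. **Shifting an entry.** Let $a$ be the bottom entry of a column of $t$ which is not the first column; let $b$ be the entry on top of $a$, if the column of $a$ is two-boxed. A shift of $a$ is possible in the following cases and modifies only the column of $a$ and the column just to its left. (1) The column just to the left of $a$ is single-boxed with entry $c$. Then these columns are replaced by a two-boxed column with bottom $a$ and top $c$, followed (if $b$ exists) by a single-boxed column $b$. (2) The column just to the left of $a$ is two-boxed with bottom $c$ and top $d$, and $a<c$. If $b$ exists and $c<b$, the two columns are replaced by the two-boxed column (bottom $a$, top $d$) followed by the two-boxed column (bottom $c$, top $b$). Otherwise they are replaced by the two-boxed column (bottom $a$, top $d$), followed by a single-boxed column $c$, followed (if $b$ exists) by a single-boxed column $b$. The result is again a standard Young-Fibonacci tableau of size $n$. **Order.** $t\preceq t'$ if there is a sequence $t_0=t,t_1,\dots,t_k=t'$ ($k\ge0$)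 in $\mathbb{YFT}_n$ such that $t_{i+1}$ is obtained from $t_i$ by shifting an entry, for $0\le i\le k-1$. **Minimal canonical permutation.** $w_{min}^{t}$ is the word obtained by reading the columns of $t$ from right to left, each column being read from top to bottom. An inversion of a permutation $\sigma$ is a couple $(j,i)$ with $1\le i<j\le n$ such that $j$ appears to the left of $i$ in the word $\sigma$. "Graded" means that the rank increases by exactly $1$ along every covering relation. -}

module Defs where

open import Data.List.Base using (List; []; _∷_; _++_; map; concatMap; filter; length; reverse; sum; upTo)
open import Data.List.Relation.Binary.Permutation.Propositional using (_↭_)
open import Data.List.Relation.Unary.All using (All)
open import Data.List.Relation.Unary.AllPairs using (AllPairs)
open import Data.Nat.Base using (ℕ; suc; _<_)
open import Data.Nat.Properties using (_<?_)
open import Data.Product.Base using (_×_; _,_)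
open import Data.Refinement using (Refinement-syntax; value)
open import Data.Unit.Base using (⊤)
open import Level using (Level; _⊔_)
open import Relation.Binary.Construct.Closure.ReflexiveTransitive using (Star)
open import Relation.Binary.Core using (Rel)
import Relation.Binary.Construct.NonStrictToStrict as ToStrict
open import Relation.Binary.PropositionalEquality.Core using (_≡_)
open import Relation.Binary.Structures using (IsPartialOrder)
open import Relation.Nullary.Negation.Core using (¬_)

-- A filled column; in `double a b` the bottom entry a comes first.
data Column : Set where
  single : (c : ℕ) → Column
  double : (bottom top : ℕ) → Column

height : Column → ℕ
height (single _)   = 1
height (double _ _) = 2

top : Column → ℕ
top (single c)   = c
top (double _ b) = b

-- The entries of a column, from top to bottom.
readColumn : Column → List ℕ
readColumn (single c)   = c ∷ []
readColumn (double a b) = b ∷ a ∷ []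

ColumnIncreasing : Column → Set
ColumnIncreasing (single _)   = ⊤
ColumnIncreasing (double a b) = a < b

-- Columns are listed from left to right; the snakeshape of a filling is its
-- word of column heights.
record IsYFTableau (n : ℕ) (cs : List Column) : Set where
  field
    shape-size        : sum (map height cs) ≡ n
    numbering         : concatMap readColumn cs ↭ map suc (upTo n)
    column-increasing : All ColumnIncreasing cs
    top-dominates     : AllPairs (λ c c′ → All (_< top c) (readColumn c′)) cs

-- The validity proof is irrelevant, so `_≡_` on YFT n is equality of the
-- underlying fillings.
YFT : ℕ → Set
YFT n = [ cs ∈ List Column ∣ IsYFTableau n cs ]

-- `Replace l r new`: shifting the bottom entry a of the column r, whose left
-- neighbour is l, replaces the two columns l, r by the columns new.
data Replace : Column → Column → List Column → Set where
  single-single : ∀ {a c} →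
    Replace (single c) (single a) (double a c ∷ [])
  single-double : ∀ {a b c} →
    Replace (single c) (double a b) (double a c ∷ single b ∷ [])
  double-single : ∀ {a c d} → a < c →
    Replace (double c d) (single a) (double a d ∷ single c ∷ [])
  double-double-< : ∀ {a b c d} → a < c → c < b →
    Replace (double c d) (double a b) (double a d ∷ double c b ∷ [])
  double-double-≮ : ∀ {a b c d} → a < c → ¬ (c < b) →
    Replace (double c d) (double a b) (double a d ∷ single c ∷ single b ∷ [])

data ShiftColumns : Rel (List Column) Level.zero where
  here  : ∀ {l r new cs} → Replace l r new →
          ShiftColumns (l ∷ r ∷ cs) (new ++ cs)
  there : ∀ {c cs cs′} → ShiftColumns cs cs′ →
          ShiftColumns (c ∷ cs) (c ∷ cs′)

Shift : ∀ {n} → Rel (YFT n) Level.zero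
Shift t t′ = ShiftColumns (value t) (value t′)

infix 4 _⪯_
_⪯_ : ∀ {n} → Rel (YFT n) Level.zero
_⪯_ = Star Shift

w-min : ∀ {n} → YFT n → List ℕ
w-min t = concatMap readColumn (reverse (value t))

-- The couples (j , i) with i < j and j to the left of i in the word. In a word
-- without repeated letters each such couple is listed exactly once.
inversions : List ℕ → List (ℕ × ℕ)
inversions []      = []
inversions (j ∷ w) = map (j ,_) (filter (_<? j) w) ++ inversions w

rank : ∀ {n} → YFT n → ℕ
rank t = length (inversions (w-min t))

module _ {a ℓ₁ ℓ₂ : Level} {A : Set a} (_≈_ : Rel A ℓ₁) (_≤_ : Rel A ℓ₂) where

  private
    _≺_ : Rel A (ℓ₁ ⊔ ℓ₂)
    _≺_ = ToStrict._<_ _≈_ _≤_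

  Covering : Rel A (a ⊔ ℓ₁ ⊔ ℓ₂)
  Covering x y = (x ≺ y) × (∀ z → ¬ ((x ≺ z) × (z ≺ y)))

  record IsGradedPoset (ρ : A → ℕ) : Set (a ⊔ ℓ₁ ⊔ ℓ₂) where
    field
      isPartialOrder : IsPartialOrder _≈_ _≤_
      rank-covering  : ∀ {x y} → Covering x y → ρ y ≡ suc (ρ x)

{-# OPTIONS --safe #-}
-- Every shift raises the rank by exactly 1. Locally, the
-- word w-min undergoes either a c → c a with a < c, or a d c → c d a with
-- a < c < d. The second is a composite of the adjacent transpositions
-- a d c → d a c → d c a → c d a, which contribute + 1 + 1 - 1. Hence the rank
-- is strictly increasing along ⪯, which gives antisymmetry, and every covering
-- relation consists of a single shift.
module Submission where

open import Defs
open import Algebra.Properties.CommutativeSemigroup using (x∙yz≈y∙xz)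
open import Data.Irrelevant using ([_])
open import Data.List.Base using (List; []; _∷_; _++_; concatMap; filter; length; map; reverse)
open import Data.List.Properties
  using (++-assoc; ++-identityʳ; concatMap-++; filter-accept; filter-reject; length-++; length-map; reverse-++)
open import Data.List.Relation.Binary.Permutation.Propositional using (_↭_; prep; swap; ↭-refl; ↭-trans)
open import Data.List.Relation.Binary.Permutation.Propositional.Properties using (filter-↭; ++⁺ʳ; ↭-length)
open import Data.List.Relation.Unary.All using (All; []; _∷_)
open import Data.List.Relation.Unary.AllPairs using (AllPairs; _∷_)
open import Data.Nat.Base using (ℕ; suc; _+_; _<_; _≤_; _≥_)
open import Data.Nat.Properties
  using (_≟_; _<?_; +-commutativeSemigroup; +-suc; <-asym; <-trans; <-irrefl; <-≤-trans; n≤1+n; ≤-refl; ≤-reflexive; ≤-trans; suc-injective)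
open import Data.Product.Base using (_,_)
import Data.Refinement as Refinement
open import Relation.Binary.Construct.Closure.ReflexiveTransitive using (ε; _◅_)
import Relation.Binary.Construct.Closure.ReflexiveTransitive.Properties as Star
open import Relation.Binary.PropositionalEquality using (_≡_; _≢_; refl; sym; trans; cong; cong₂; subst₂; module ≡-Reasoning)
open import Relation.Nullary.Decidable using (recompute)
open import Relation.Nullary.Negation using (contradiction)

open ≡-Reasoning

below : ℕ → List ℕ → ℕ
below j w = length (filter (_<? j) w)

inv : List ℕ → ℕ
inv w = length (inversions w)

inv-∷ : ∀ j w → inv (j ∷ w) ≡ below j w + inv w
inv-∷ j w = trans (length-++ (map (j ,_) (filter (_<? j) w)))
                  (cong (_+ inv w) (length-map (j ,_) (filter (_<? j) w)))

below-↭ : ∀ j {v w} → v ↭ w → below j v ≡ below j w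
below-↭ j v↭w = ↭-length (filter-↭ (_<? j) v↭w)

-- Each of the two letters has the same letters of `s` below it in either order, and the pair itself
-- is an inversion only when `c` comes first.
inv-swap : ∀ {a c} → a < c → ∀ s → inv (c ∷ a ∷ s) ≡ suc (inv (a ∷ c ∷ s))
inv-swap {a} {c} a<c s = begin
  inv (c ∷ a ∷ s)                          ≡⟨ inv-∷ c (a ∷ s) ⟩
  below c (a ∷ s) + inv (a ∷ s)            ≡⟨ cong₂ _+_ (cong length (filter-accept (_<? c) a<c)) (inv-∷ a s) ⟩
  suc (below c s + (below a s + inv s))    ≡⟨ cong suc (x∙yz≈y∙xz +-commutativeSemigroup (below c s) (below a s) (inv s)) ⟩
  suc (below a s + (below c s + inv s))    ≡⟨ cong suc (cong₂ _+_ (cong length (filter-reject (_<? a) (<-asym a<c))) (inv-∷ c s)) ⟨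
  suc (below a (c ∷ s) + inv (c ∷ s))      ≡⟨ cong suc (inv-∷ a (c ∷ s)) ⟨
  suc (inv (a ∷ c ∷ s))                    ∎

-- The inversions starting at `j` depend only on which letters follow it, not on their order.
inv-∷-suc : ∀ j {v w} → v ↭ w → inv w ≡ suc (inv v) → inv (j ∷ w) ≡ suc (inv (j ∷ v))
inv-∷-suc j {v} {w} v↭w eq = begin
  inv (j ∷ w)               ≡⟨ inv-∷ j w ⟩
  below j w + inv w         ≡⟨ cong₂ _+_ (sym (below-↭ j v↭w)) eq ⟩
  below j v + suc (inv v)   ≡⟨ +-suc (below j v) (inv v) ⟩
  suc (below j v + inv v)   ≡⟨ cong suc (inv-∷ j v) ⟨
  suc (inv (j ∷ v))         ∎

inv-exchange : ∀ {a c d} → a < c → c < d → ∀ s →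
               inv (c ∷ d ∷ a ∷ s) ≡ suc (inv (a ∷ d ∷ c ∷ s))
-- Both words are compared with `d c a s`, which lies one above the left side and two above
-- `a d c s`; cancelling a `suc` accounts for the summand - 1.
inv-exchange {a} {c} {d} a<c c<d s = suc-injective (begin
  suc (inv (c ∷ d ∷ a ∷ s))        ≡⟨ inv-swap c<d (a ∷ s) ⟨
  inv (d ∷ c ∷ a ∷ s)              ≡⟨ inv-∷-suc d (swap a c ↭-refl) (inv-swap a<c s) ⟩
  suc (inv (d ∷ a ∷ c ∷ s))        ≡⟨ cong suc (inv-swap (<-trans a<c c<d) (c ∷ s)) ⟩
  suc (suc (inv (a ∷ d ∷ c ∷ s)))  ∎)

infix 4 _⋖_

-- Quantifying over the suffix makes the relation a congruence for _++_.
record _⋖_ (v w : List ℕ) : Set where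
  field
    perm    : v ↭ w
    inv-suc : ∀ s → inv (w ++ s) ≡ suc (inv (v ++ s))

open _⋖_

-- This is the purpose of the field `perm`: a letter put in front must form equally many inversions
-- with either word.
⋖-∷ : ∀ j {v w} → v ⋖ w → j ∷ v ⋖ j ∷ w
⋖-∷ j v⋖w .perm      = prep j (v⋖w .perm)
⋖-∷ j v⋖w .inv-suc s = inv-∷-suc j (++⁺ʳ s (v⋖w .perm)) (v⋖w .inv-suc s)

⋖-++ˡ : ∀ u {v w} → v ⋖ w → u ++ v ⋖ u ++ w
⋖-++ˡ []      v⋖w = v⋖w
⋖-++ˡ (j ∷ u) v⋖w = ⋖-∷ j (⋖-++ˡ u v⋖w)

⋖-++ʳ : ∀ u {v w} → v ⋖ w → v ++ u ⋖ w ++ u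
⋖-++ʳ u v⋖w .perm = ++⁺ʳ u (v⋖w .perm)
⋖-++ʳ u {v} {w} v⋖w .inv-suc s
  rewrite ++-assoc v u s | ++-assoc w u s = v⋖w .inv-suc (u ++ s)

⋖-swap : ∀ {a c} → a < c → a ∷ c ∷ [] ⋖ c ∷ a ∷ []
⋖-swap {a} {c} a<c .perm      = swap a c ↭-refl
⋖-swap a<c .inv-suc s         = inv-swap a<c s

⋖-exchange : ∀ {a c d} → a < c → c < d → a ∷ d ∷ c ∷ [] ⋖ c ∷ d ∷ a ∷ []
⋖-exchange {a} {c} {d} a<c c<d .perm =
  ↭-trans (prep a (swap d c ↭-refl)) (↭-trans (swap a c ↭-refl) (prep c (swap a d ↭-refl)))
⋖-exchange a<c c<d .inv-suc s = inv-exchange a<c c<d s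

readColumns : List Column → List ℕ
readColumns cs = concatMap readColumn (reverse cs)

readColumns-++ : ∀ cs ds → readColumns (cs ++ ds) ≡ readColumns ds ++ readColumns cs
readColumns-++ cs ds = trans (cong (concatMap readColumn) (reverse-++ cs ds))
                             (concatMap-++ readColumn (reverse ds) (reverse cs))

readColumns-∷ : ∀ c cs → readColumns (c ∷ cs) ≡ readColumns cs ++ readColumn c
readColumns-∷ c cs = trans (readColumns-++ (c ∷ []) cs)
                           (cong (readColumns cs ++_) (++-identityʳ (readColumn c)))

Dominates : Column → Column → Set
Dominates c c′ = All (_< top c) (readColumn c′)

-- If `r` has a top entry `b`, it is read first both before and after the shift, hence the common
-- prefix `⋖-∷ _`. Comparing `c` with `b` only decides whether they share a column: both
-- double-double cases end in the word `b c d a`. The inequality `a<c` comes from the dominance of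
-- `l` when `l` is single, and from the shift itself when `l` is double.
replace-⋖ : ∀ {l r new} → Replace l r new → ColumnIncreasing l → Dominates l r →
            readColumns (l ∷ r ∷ []) ⋖ readColumns new
replace-⋖ single-single               _   (a<c ∷ [])     = ⋖-swap a<c
replace-⋖ single-double               _   (_ ∷ a<c ∷ []) = ⋖-∷ _ (⋖-swap a<c)
replace-⋖ (double-single a<c)         c<d _              = ⋖-exchange a<c c<d
replace-⋖ (double-double-< a<c _)     c<d _              = ⋖-∷ _ (⋖-exchange a<c c<d)
replace-⋖ (double-double-≮ a<c _)     c<d _              = ⋖-∷ _ (⋖-exchange a<c c<d)

-- As columns are read from right to left, those to the right of the shifted pair form a common
-- prefix and those to its left a common suffix.
shift-⋖ : ∀ {cs cs′} → ShiftColumns cs cs′ → All ColumnIncreasing cs → AllPairs Dominates cs →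
          readColumns cs ⋖ readColumns cs′
shift-⋖ (here {l} {r} {new} {cs} rep) (inc ∷ _) ((dom ∷ _) ∷ _) =
  subst₂ _⋖_ (sym (readColumns-++ (l ∷ r ∷ []) cs)) (sym (readColumns-++ new cs))
    (⋖-++ˡ (readColumns cs) (replace-⋖ rep inc dom))
shift-⋖ (there {c} {cs} {cs′} sh) (_ ∷ incs) (_ ∷ doms) =
  subst₂ _⋖_ (sym (readColumns-∷ c cs)) (sym (readColumns-∷ c cs′))
    (⋖-++ʳ (readColumn c) (shift-⋖ sh incs doms))

⋖⇒inv-suc : ∀ {v w} → v ⋖ w → inv w ≡ suc (inv v)
⋖⇒inv-suc {v} {w} v⋖w =
  subst₂ (λ x y → inv x ≡ suc (inv y)) (++-identityʳ w) (++-identityʳ v) (v⋖w .inv-suc [])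

module _ {n : ℕ} where

  -- The validity of a tableau is irrelevant, so the equation is recomputed
  -- from the decidability of equality on ℕ.
  rank-shift : ∀ {t t′ : YFT n} → Shift t t′ → rank t′ ≡ suc (rank t)
  rank-shift {cs Refinement., [ valid ]} {t′} sh =
    recompute (_ ≟ _) (⋖⇒inv-suc (shift-⋖ sh (column-increasing valid) (top-dominates valid)))
    where open IsYFTableau

  rank-mono : ∀ {t t′ : YFT n} → t ⪯ t′ → rank t ≤ rank t′
  rank-mono ε = ≤-refl
  rank-mono {t} (_◅_ {j = u} sh p) =
    ≤-trans (n≤1+n (rank t)) (≤-trans (≤-reflexive (sym (rank-shift {t} {u} sh))) (rank-mono p))

  shift⇒rank-< : ∀ {t t′ : YFT n} → Shift t t′ → rank t < rank t′
  shift⇒rank-< {t} {t′} sh = ≤-reflexive (sym (rank-shift {t} {t′} sh))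

  shift⇒≢ : ∀ {t t′ : YFT n} → Shift t t′ → t ≢ t′
  shift⇒≢ {t} {t′} sh t≡t′ = <-irrefl (cong rank t≡t′) (shift⇒rank-< {t} {t′} sh)

  -- A cycle containing at least one shift would give `rank t < rank t`.
  ⪯-antisym : ∀ {t t′ : YFT n} → t ⪯ t′ → t′ ⪯ t → t ≡ t′
  ⪯-antisym ε                      _ = refl
  ⪯-antisym {t} (_◅_ {j = u} sh p) q =
    contradiction (<-≤-trans (shift⇒rank-< {t} {u} sh) (≤-trans (rank-mono p) (rank-mono q)))
                  (<-irrefl refl)

  -- In a chain of two or more shifts, the tableau `u` reached by the first one lies strictly
  -- between the endpoints, so a covering pair is joined by exactly one shift.
  covering⇒rank-suc : ∀ {t t′ : YFT n} → Covering _≡_ _⪯_ t t′ → rank t′ ≡ suc (rank t)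
  covering⇒rank-suc ((ε , t≢t) , _) = contradiction refl t≢t
  covering⇒rank-suc {t} {t′} ((sh ◅ ε , _) , _) = rank-shift {t} {t′} sh
  covering⇒rank-suc {t} ((_◅_ {j = u} sh (_◅_ {j = v} sh′ p) , _) , none) =
    contradiction ((sh ◅ ε , shift⇒≢ {t} {u} sh) , (sh′ ◅ p , u≢t′)) (none u)
    where
    u≢t′ : u ≢ _
    -- The chain from `u` to the upper endpoint still begins with the shift `sh′`, so the rank rises
    -- strictly along it.
    u≢t′ u≡t′ = <-irrefl (cong rank u≡t′) (<-≤-trans (shift⇒rank-< {u} {v} sh′) (rank-mono p))

proposition5p5 : ∀ (n : ℕ) → n ≥ 1 → IsGradedPoset {A = YFT n} _≡_ _⪯_ rank
proposition5p5 n _ = record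
  { isPartialOrder = record
    { isPreorder = Star.isPreorder Shift
    ; antisym    = ⪯-antisym
    }
  ; rank-covering  = covering⇒rank-suc
  }
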